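{- Let $G$ be a graph. The linear map $\Delta_G:H(\mathcal{G})\to H(\mathcal{G})\otimes H(\mathcal{G})$ given on $F\in M(\mathcal{G})$ by the combinatorial formula $$\Delta_G(F)=\sum_{U\uplus V=V(F)}F[U]\otimes F[V]$$ coincides with the coproduct $\Delta_G$ defined by linearity and the three rules: $\Delta_G(\mathbf{1})=\mathbf{1}\otimes\mathbf{1}$; $\Delta_G(\Gamma)=\sum_{V_1\sqcup V_2=V(\Gamma)}\Gamma[V_1]\otimes\Gamma[V_2]$ for $\Gamma\in\mathcal{G}$; and $\Delta_G(\Gamma_1\cdots\Gamma_n)=\Delta_G(\Gamma_1)\cdots\Delta_G(\Gamma_n)$ for $n\ge2$ and $\Gamma_1,\dots,\Gamma_n\in\mathcal{G}$.
   Context: $\mathbf{k}$ is a unitary commutative ring; tensor products and linear maps are over $\mathbf{k}$. Graphs are connected and undirected, without multiple edges and loops (induced subgraphs of them may be disconnected). $G$ is a graph with vertices labelled by natural numbers, the labels distinguishing the vertices from one another. $\mathcal{G}$ is the set of nonempty connected subgraphs of $G$ (a subgraph is a graph all of whose vertices lie in $V(G)$ and all of whose edges lie in $E(G)$). $M(\mathcal{G})$ is the free (noncommutative) monoid on $\mathcal{G}$, with multiplication given by concatenation and unit the empty graph $\mathbf{1}$. $H(\mathcal{G})=\mathbf{k}M(\mathcal{G})$ is the free $\mathbf{k}$-module on $M(\mathcal{G})$, with multiplication extended linearly. For $\Gamma\in\mathcal{G}$ and $U\subseteq V(\Gamma)$, $\Gamma[U]$ is the subgraph of $\Gamma$ induced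 by $U$, regarded as an element of $M(\mathcal{G})$, i.e. as a product of its connected components (no order of the factors is specified); $\Gamma[\emptyset]$ is the empty graph $\mathbf{1}$. Sums over $V_1\sqcup V_2=V(\Gamma)$ run over ordered pairs of disjoint subsets with union $V(\Gamma)$. For $F=\Gamma_1\cdots\Gamma_n\in M(\mathcal{G})$ with $\Gamma_i\in\mathcal{G}$, $V(F)$ is the multiset of vertices of $F$. The notation $U\uplus V=V(F)$ means that $U=U_1\cup\cdots\cup U_n$ and $V=V_1\cup\cdots\cup V_n$ with $U_i\sqcup V_i=V(\Gamma_i)$ for $i=1,\dots,n$; the sum is over all such choices of $(U_i,V_i)_{i}$, and $F[U]=\Gamma_1[U_1]\cdots\Gamma_n[U_n]$, $F[V]=\Gamma_1[V_1]\cdots\Gamma_n[V_n]$. -}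

module Defs where

open import Level using (_⊔_; 0ℓ)
open import Algebra.Bundles using (CommutativeRing; CommutativeMonoid)
open import Algebra.Module.Bundles using (Module)
open import Algebra.Module.Morphism.Structures using (module ModuleMorphisms)
open import Algebra.Module.Structures using (IsLeftModule)
open import Algebra.Module.Structures.Biased using (IsModuleFromLeft)
open import Data.Empty using () renaming (⊥ to Empty)
open import Data.Fin.Base as Fin using (Fin)
open import Data.Fin.Properties as Fin using (all?; ¬∀⟶∃¬-smallest)
open import Data.Fin.Subset using (Subset; inside; outside; _∈_; _⊆_; Nonempty; _∩_; _∪_; ⊥)
open import Data.Fin.Subset.Properties using (_∈?_; nonempty?; ⊆-antisym)
open import Data.Bool.Properties as Bool using ()
open import Data.List.Base as List using (List; []; _∷_; _++_; cartesianProduct; cartesianProductWith)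
open import Data.List.NonEmpty as List⁺ using (List⁺)
open import Data.List.Membership.Propositional as List using ()
open import Data.List.Membership.Propositional.Properties as List using ()
open import Data.List.Relation.Unary.All as All using (All; []; _∷_)
open import Data.List.Relation.Unary.AllPairs using ([]; _∷_)
open import Data.List.Relation.Unary.Any using (here; there)
open import Data.List.Relation.Unary.Unique.Propositional using (Unique)
import Data.List.Relation.Unary.Unique.Propositional.Properties as Unique
import Data.Nat.Properties as ℕ
open import Data.Nat.Base using (ℕ; zero; suc)
open import Data.Product.Base using (_×_; _,_; proj₁; proj₂; ∃)
open import Data.Sum.Base using (_⊎_; inj₁; inj₂)
open import Data.Vec.Base as Vec using (Vec; []; _∷_; lookup; tabulate)
open import Data.Vec.Properties as Vec using (≡-dec; lookup∘tabulate; tabulate∘lookup; tabulate-cong; []=⇒lookup; lookup⇒[]=)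
open import Function.Base using (_∘_)
open import Function.Bundles using (_⇔_; mk⇔)
open import Function.Definitions using (Injective)
open import Relation.Binary.Core using (Rel)
open import Relation.Binary.Definitions using (Decidable; Symmetric; Irreflexive)
open import Relation.Binary.Construct.Closure.ReflexiveTransitive using (Star; ε; _◅_; _◅◅_; gmap; reverse)
open import Relation.Binary.PropositionalEquality using (_≡_; _≢_; refl; sym; trans; subst)
open import Relation.Nullary using (Dec; yes; no; ¬_; does; recompute; contradiction)
open import Relation.Nullary.Decidable using (_×-dec_; _⊎-dec_; _→-dec_; map′; ¬?; dec-true; decidable-stable)
import Relation.Unary as Unary

subset : ∀ {n p} {P : Fin n → Set p} → Unary.Decidable P → Subset n
subset P? = tabulate (does ∘ P?)

∈-subset⁺ : ∀ {n p} {P : Fin n → Set p} (P? : Unary.Decidable P) {i} → P i → i ∈ subset P?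
∈-subset⁺ P? {i} Pi =
  lookup⇒[]= i _ (trans (lookup∘tabulate (does ∘ P?) i) (dec-true (P? i) Pi))

∈-subset⁻ : ∀ {n p} {P : Fin n → Set p} (P? : Unary.Decidable P) {i} → i ∈ subset P? → P i
∈-subset⁻ P? {i} i∈ with P? i | trans (sym (lookup∘tabulate (does ∘ P?) i)) ([]=⇒lookup i∈)
... | yes Pi | _  = Pi
... | no _   | ()

subsets : ∀ n → List (Subset n)
subsets zero    = [] ∷ []
subsets (suc n) = List.map (outside ∷_) (subsets n) ++ List.map (inside ∷_) (subsets n)

∈-subsets : ∀ {n} (U : Subset n) → U List.∈ subsets n
∈-subsets []            = here refl
∈-subsets (outside ∷ U) = List.∈-++⁺ˡ (List.∈-map⁺ (outside ∷_) (∈-subsets U))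
∈-subsets {suc n} (inside ∷ U) =
  List.∈-++⁺ʳ (List.map (outside ∷_) (subsets n)) (List.∈-map⁺ (inside ∷_) (∈-subsets U))

subsets-unique : ∀ n → Unique (subsets n)
subsets-unique zero    = [] ∷ []
subsets-unique (suc n) = Unique.++⁺
  (Unique.map⁺ Vec.∷-injectiveʳ (subsets-unique n))
  (Unique.map⁺ Vec.∷-injectiveʳ (subsets-unique n))
  λ (U∈ , U∈′) → disjoint (List.∈-map⁻ _ U∈) (List.∈-map⁻ _ U∈′)
  where
  disjoint : ∀ {U} → ∃ (λ V → V List.∈ subsets n × U ≡ outside ∷ V) →
             ∃ (λ V → V List.∈ subsets n × U ≡ inside ∷ V) → Empty
  disjoint (_ , _ , refl) (_ , _ , ())

IsSplit : ∀ {n} → Subset n → Subset n × Subset n → Set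
IsSplit W (V₁ , V₂) = (V₁ ∩ V₂ ≡ ⊥) × (V₁ ∪ V₂ ≡ W)

isSplit? : ∀ {n} (W : Subset n) → Unary.Decidable (IsSplit W)
isSplit? W (V₁ , V₂) = ≡-dec Bool._≟_ (V₁ ∩ V₂) ⊥ ×-dec ≡-dec Bool._≟_ (V₁ ∪ V₂) W

splits : ∀ {n} → Subset n → List (Subset n × Subset n)
splits {n} W = List.filter (isSplit? W) (cartesianProduct (subsets n) (subsets n))

∈-splits : ∀ {n} (W : Subset n) S → S List.∈ splits W ⇔ IsSplit W S
∈-splits {n} W (V₁ , V₂) = mk⇔
  (λ S∈ → proj₂ (List.∈-filter⁻ (isSplit? W) {xs = cartesianProduct (subsets n) (subsets n)} S∈))
  (List.∈-filter⁺ (isSplit? W) (List.∈-cartesianProduct⁺ (∈-subsets V₁) (∈-subsets V₂)))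

splits-unique : ∀ {n} (W : Subset n) → Unique (splits W)
splits-unique {n} W = Unique.filter⁺ (isSplit? W)
  (Unique.cartesianProduct⁺ (subsets-unique n) (subsets-unique n))

-- Reachability in a finite decidable relation, by the Floyd-Warshall
-- recursion on the list of allowed intermediate points.

module _ {n} {T : Rel (Fin n) 0ℓ} (T? : Decidable T) where

  private
    Via : List (Fin n) → Rel (Fin n) 0ℓ
    Via []       u v = u ≡ v ⊎ T u v
    Via (w ∷ ws) u v = Via ws u v ⊎ (Via ws u w × Via ws w v)

    via? : ∀ ws → Decidable (Via ws)
    via? []       u v = (u Fin.≟ v) ⊎-dec T? u v
    via? (w ∷ ws) u v = via? ws u v ⊎-dec (via? ws u w ×-dec via? ws w v)

    sound : ∀ ws {u v} → Via ws u v → Star T u v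
    sound []       (inj₁ refl)    = ε
    sound []       (inj₂ t)       = t ◅ ε
    sound (w ∷ ws) (inj₁ p)       = sound ws p
    sound (w ∷ ws) (inj₂ (p , q)) = sound ws p ◅◅ sound ws q

    via-refl : ∀ ws {u} → Via ws u u
    via-refl []       = inj₁ refl
    via-refl (_ ∷ ws) = inj₁ (via-refl ws)

    via-step : ∀ ws {u v} → T u v → Via ws u v
    via-step []       t = inj₂ t
    via-step (_ ∷ ws) t = inj₁ (via-step ws t)

    to-head : ∀ {x ws u} → Via (x ∷ ws) u x → Via ws u x
    to-head (inj₁ p)       = p
    to-head (inj₂ (p , _)) = p

    from-head : ∀ {x ws v} → Via (x ∷ ws) x v → Via ws x v
    from-head (inj₁ p)       = p
    from-head (inj₂ (_ , q)) = q

    via-trans : ∀ {ws w u v} → w List.∈ ws → Via ws u w → Via ws w v → Via ws u v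
    via-trans {x ∷ ws} (here refl) p q =
      inj₂ (to-head {x} {ws} p , from-head {x} {ws} q)
    via-trans (there w∈) (inj₁ p)       (inj₁ q)       = inj₁ (via-trans w∈ p q)
    via-trans (there w∈) (inj₁ p)       (inj₂ (q , r)) = inj₂ (via-trans w∈ p q , r)
    via-trans (there w∈) (inj₂ (p , q)) (inj₁ r)       = inj₂ (p , via-trans w∈ q r)
    via-trans (there w∈) (inj₂ (p , _)) (inj₂ (_ , r)) = inj₂ (p , r)

    complete : ∀ {u v} → Star T u v → Via (List.allFin n) u v
    complete ε       = via-refl (List.allFin n)
    complete (t ◅ p) = via-trans (List.∈-allFin _) (via-step (List.allFin n) t) (complete p)

  star? : Decidable (Star T)
  star? u v = map′ (sound (List.allFin n)) complete (via? (List.allFin n) u v)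

record Graph : Set₁ where
  field
    order           : ℕ
    label           : Fin order → ℕ
    label-injective : Injective _≡_ _≡_ label
    Adj             : Rel (Fin order) 0ℓ
    adj?            : Decidable Adj
    adj-sym         : Symmetric Adj
    adj-irrefl      : Irreflexive _≡_ Adj
    connected       : ∀ u v → Star Adj u v

module _ (G : Graph) where
  open Graph G using (order; Adj)

  -- The edge set is stored as a symmetric adjacency matrix; v ∈ lookup E u
  -- means that uv is an edge.  The proof fields are irrelevant, so that
  -- two subgraphs with the same vertices and the same edges are
  -- propositionally equal.

  record Subgraph : Set where
    constructor mkSubgraph
    field
      V    : Subset order
      E    : Vec (Subset order) order
      .E-sym : ∀ {u v} → v ∈ lookup E u → u ∈ lookup E v
      .E⊆V   : ∀ {u v} → v ∈ lookup E u → u ∈ V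
      .E⊆G   : ∀ {u v} → v ∈ lookup E u → Adj u v

    Edge : Rel (Fin order) 0ℓ
    Edge u v = v ∈ lookup E u

    edge? : Decidable Edge
    edge? u v = v ∈? lookup E u

  Connected : Subgraph → Set
  Connected H = ∀ {u v} → u ∈ V → v ∈ V → Star Edge u v
    where open Subgraph H

  -- The set 𝒢.
  record ConnectedSubgraph : Set where
    constructor mkConnected
    field
      subgraph   : Subgraph
      .nonempty  : Nonempty (Subgraph.V subgraph)
      .connected : Connected subgraph

    open Subgraph subgraph public

-- The irrelevant fields are decidable and can be recovered.

module _ {G : Graph} where
  open Graph G using (order; Adj; adj?)
  open Subgraph using (V; E; Edge; edge?)

  edge-sym : ∀ (H : Subgraph G) {u v} → Edge H u v → Edge H v u
  edge-sym H@(mkSubgraph _ _ E-sym _ _) {u} {v} e = recompute (edge? H v u) (E-sym e)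

  edge-source : ∀ (H : Subgraph G) {u v} → Edge H u v → u ∈ V H
  edge-source H@(mkSubgraph _ _ _ E⊆V _) {u} e = recompute (u ∈? V H) (E⊆V e)

  edge-adj : ∀ (H : Subgraph G) {u v} → Edge H u v → Adj u v
  edge-adj (mkSubgraph _ _ _ _ E⊆G) {u} {v} e = recompute (adj? u v) (E⊆G e)

  inhabited : ∀ (Γ : ConnectedSubgraph G) → Nonempty (ConnectedSubgraph.V Γ)
  inhabited (mkConnected H nonempty _) = recompute (nonempty? (V H)) nonempty

  walk : ∀ (Γ : ConnectedSubgraph G) → Connected G (ConnectedSubgraph.subgraph Γ)
  walk (mkConnected H _ connected) {u} {v} u∈ v∈ =
    recompute (star? (edge? H) u v) (connected u∈ v∈)

  infix 4 _⊑_

  _⊑_ : Rel (Subgraph G) 0ℓ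
  H ⊑ K = V H ⊆ V K × (∀ {u v} → Edge H u v → Edge K u v)

  ⊑-antisym : ∀ {H K : Subgraph G} → H ⊑ K → K ⊑ H → H ≡ K
  ⊑-antisym {H} {K} (V⊆ , E⊆) (V⊇ , E⊇) = build (⊆-antisym V⊆ V⊇) rows
    where
    rows : E H ≡ E K
    rows = trans (sym (tabulate∘lookup (E H)))
      (trans (tabulate-cong (λ _ → ⊆-antisym E⊆ E⊇)) (tabulate∘lookup (E K)))
    build : ∀ {H K : Subgraph G} → V H ≡ V K → E H ≡ E K → H ≡ K
    build refl refl = refl

  ConnectedSubgraph-≡ : ∀ {C D : ConnectedSubgraph G} →
    ConnectedSubgraph.subgraph C ≡ ConnectedSubgraph.subgraph D → C ≡ D
  ConnectedSubgraph-≡ refl = refl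

  induced : Subgraph G → Subset order → Subgraph G
  induced H U = mkSubgraph (V H ∩ U) (tabulate row) E-sym E⊆V E⊆G
    where
    Inside : Rel (Fin order) 0ℓ
    Inside u v = Edge H u v × u ∈ U × v ∈ U

    inside? : Decidable Inside
    inside? u v = edge? H u v ×-dec (u ∈? U ×-dec v ∈? U)

    row : Fin order → Subset order
    row u = subset (inside? u)

    out : ∀ {u v} → v ∈ lookup (tabulate row) u → Inside u v
    out {u} {v} e = ∈-subset⁻ (inside? u) (subst (v ∈_) (lookup∘tabulate row u) e)

    E-sym : ∀ {u v} → v ∈ lookup (tabulate row) u → u ∈ lookup (tabulate row) v
    E-sym {u} {v} e with out e
    ... | e′ , u∈ , v∈ = subst (u ∈_) (sym (lookup∘tabulate row v))
      (∈-subset⁺ (inside? v) (edge-sym H e′ , v∈ , u∈))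

    E⊆V : ∀ {u v} → v ∈ lookup (tabulate row) u → u ∈ V H ∩ U
    E⊆V e with out e
    ... | e′ , u∈ , _ = x∈p∩q⁺ (edge-source H e′ , u∈)
      where open import Data.Fin.Subset.Properties using (x∈p∩q⁺)

    E⊆G : ∀ {u v} → v ∈ lookup (tabulate row) u → Adj u v
    E⊆G e = edge-adj H (proj₁ (out e))

  record IsComponent (H : Subgraph G) (C : ConnectedSubgraph G) : Set where
    field
      contained : ConnectedSubgraph.subgraph C ⊑ H
      maximal   : ∀ (D : ConnectedSubgraph G) →
                  ConnectedSubgraph.subgraph C ⊑ ConnectedSubgraph.subgraph D →
                  ConnectedSubgraph.subgraph D ⊑ H →
                  C ≡ D

-- A possibly disconnected subgraph, such as Γ[U], is read as the product
-- of its components in M(𝒢).  No order of the factors is prescribed, so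
-- the order is a parameter: an arbitrary listing of the components of
-- each subgraph, every component occurring exactly once.

record ComponentOrder (G : Graph) : Set where
  field
    components        : Subgraph G → List (ConnectedSubgraph G)
    components-exact  : ∀ H C → C List.∈ components H ⇔ IsComponent H C
    components-unique : ∀ H → Unique (components H)

-- Such a listing exists: order the components by their least vertex.

module _ (G : Graph) where
  open Graph G using (order; Adj)
  open Subgraph using (V; E; Edge; edge?)
  open ConnectedSubgraph using (subgraph)

  private
    module At (H : Subgraph G) where

      Reach : Rel (Fin order) 0ℓ
      Reach = Star (Edge H)

      reach? : Decidable Reach
      reach? = star? (edge? H)

      reach-sym : Symmetric Reach
      reach-sym = reverse (edge-sym H)

      module _ (r : Fin order) where

        InClass : Rel (Fin order) 0ℓ
        InClass u v = Edge H u v × Reach r u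

        inClass? : Decidable InClass
        inClass? u v = edge? H u v ×-dec reach? r u

        row : Fin order → Subset order
        row u = subset (inClass? u)

        class-edge⁻ : ∀ {u v} → v ∈ lookup (tabulate row) u → InClass u v
        class-edge⁻ {u} {v} e = ∈-subset⁻ (inClass? u) (subst (v ∈_) (lookup∘tabulate row u) e)

        class-edge⁺ : ∀ {u v} → InClass u v → v ∈ lookup (tabulate row) u
        class-edge⁺ {u} {v} e = subst (v ∈_) (sym (lookup∘tabulate row u)) (∈-subset⁺ (inClass? u) e)

        class : Subgraph G
        class = mkSubgraph (subset (reach? r)) (tabulate row)
          (λ e → let (e′ , p) = class-edge⁻ e in class-edge⁺ (edge-sym H e′ , p ◅◅ e′ ◅ ε))
          (λ e → ∈-subset⁺ (reach? r) (proj₂ (class-edge⁻ e)))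
          (λ e → edge-adj H (proj₁ (class-edge⁻ e)))

        stay : ∀ {u v} → Reach r u → Reach u v → Star (Edge class) u v
        stay p ε       = ε
        stay p (e ◅ q) = class-edge⁺ (e , p) ◅ stay (p ◅◅ e ◅ ε) q

        component : ConnectedSubgraph G
        component = mkConnected class (r , ∈-subset⁺ (reach? r) ε) λ u∈ v∈ →
          let p = ∈-subset⁻ (reach? r) u∈
              q = ∈-subset⁻ (reach? r) v∈
          in stay p (reach-sym p ◅◅ q)

      Least : Fin order → Set
      Least r = r ∈ V H × (∀ u → Reach u r → r Fin.≤ u)

      least? : Unary.Decidable Least
      least? r = (r ∈? V H) ×-dec all? (λ u → reach? u r →-dec (r Fin.≤? u))

      in-H : ∀ {u v} → u ∈ V H → Reach u v → v ∈ V H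
      in-H u∈ ε       = u∈
      in-H u∈ (e ◅ p) = in-H (edge-source H (edge-sym H e)) p

      least-reach : ∀ {r s} → Least r → Least s → Reach r s → r ≡ s
      least-reach (_ , r≤) (_ , s≤) p = Fin.≤-antisym (r≤ _ (reach-sym p)) (s≤ _ p)

      component-injective : ∀ {r s} → Least r → Least s → component r ≡ component s → r ≡ s
      component-injective {r} {s} lr ls eq = least-reach lr ls
        (∈-subset⁻ (reach? r)
          (subst (λ C → s ∈ ConnectedSubgraph.V C) (sym eq) (∈-subset⁺ (reach? s) ε)))

      find-least : ∀ {v} → v ∈ V H → ∃ λ r → Least r × Reach r v
      find-least {v} v∈
        with ¬∀⟶∃¬-smallest order (λ u → ¬ Reach u v) (λ u → ¬? (reach? u v)) (λ none → none v ε)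
      ... | r , ¬¬p , smaller = r , (in-H v∈ (reach-sym p) , below) , p
        where
        p : Reach r v
        p = decidable-stable (reach? r v) ¬¬p
        below : ∀ u → Reach u r → r Fin.≤ u
        below u q with r Fin.≤? u
        ... | yes r≤u = r≤u
        ... | no  r≰u = contradiction (q ◅◅ p)
          (subst (λ w → ¬ Reach w v) back (smaller (Fin.fromℕ< u<r)))
          where
          u<r = ℕ.≰⇒> r≰u
          back : Fin.inject (Fin.fromℕ< u<r) ≡ u
          back = Fin.toℕ-injective (trans (Fin.toℕ-inject (Fin.fromℕ< u<r)) (Fin.toℕ-fromℕ< u<r))

      component-isComponent : ∀ {r} → r ∈ V H → IsComponent H (component r)
      component-isComponent {r} r∈ = record
        { contained = (λ v∈ → in-H r∈ (∈-subset⁻ (reach? r) v∈)) , (proj₁ ∘ class-edge⁻ r)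
        ; maximal   = λ D (C⊆D , E⊆) (D⊆H , F⊆) →
            let r∈D = C⊆D (∈-subset⁺ (reach? r) ε)
                reach : ∀ {v} → v ∈ ConnectedSubgraph.V D → Reach r v
                reach v∈ = gmap (λ x → x) F⊆ (walk D r∈D v∈)
            in ConnectedSubgraph-≡ (⊑-antisym (C⊆D , E⊆)
                 ( (λ v∈ → ∈-subset⁺ (reach? r) (reach v∈))
                 , (λ e → class-edge⁺ r (F⊆ e , reach (edge-source (subgraph D) e)))))
        }

      components : List (ConnectedSubgraph G)
      components = List.map component (List.filter least? (List.allFin order))

      exact : ∀ C → C List.∈ components ⇔ IsComponent H C
      exact C = mk⇔ to from
        where
        to : C List.∈ components → IsComponent H C
        to C∈ with List.∈-map⁻ component C∈
        ... | r , r∈ , refl =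
          component-isComponent (proj₁ (proj₂ (List.∈-filter⁻ least? {xs = List.allFin order} r∈)))

        from : IsComponent H C → C List.∈ components
        from isC with inhabited C
        ... | v , v∈ with find-least (proj₁ (IsComponent.contained isC) v∈)
        ... | r , lr , p = subst (List._∈ components) (sym C≡) (List.∈-map⁺ component
                             (List.∈-filter⁺ least? (List.∈-allFin r) lr))
          where
          reach : ∀ {u} → u ∈ ConnectedSubgraph.V C → Reach r u
          reach u∈ = p ◅◅ gmap (λ x → x) (proj₂ (IsComponent.contained isC)) (walk C v∈ u∈)
          C≡ : C ≡ component r
          C≡ = IsComponent.maximal isC (component r)
            ( (λ u∈ → ∈-subset⁺ (reach? r) (reach u∈))
            , (λ e → class-edge⁺ r ( proj₂ (IsComponent.contained isC) e
                                   , reach (edge-source (subgraph C) e))))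
            (IsComponent.contained (component-isComponent (proj₁ lr)))

      unique : Unique components
      unique = go (List.filter least? (List.allFin order)) (proj₂ ∘ List.∈-filter⁻ least? {xs = List.allFin order})
                 (Unique.filter⁺ least? (Unique.allFin⁺ order))
        where
        distinct : ∀ {r} → Least r → ∀ rs → (∀ {s} → s List.∈ rs → Least s) →
                   All (r ≢_) rs → All (component r ≢_) (List.map component rs)
        distinct lr []       ls []         = []
        distinct lr (s ∷ rs) ls (r≢ ∷ r≢s) =
          r≢ ∘ component-injective lr (ls (here refl)) ∷ distinct lr rs (ls ∘ there) r≢s

        go : ∀ rs → (∀ {s} → s List.∈ rs → Least s) → Unique rs → Unique (List.map component rs)
        go []       ls []       = []
        go (r ∷ rs) ls (d ∷ ds) = distinct (ls (here refl)) rs (ls ∘ there) d ∷ go rs (ls ∘ there) ds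

  leastVertexOrder : ComponentOrder G
  leastVertexOrder = record
    { components        = At.components
    ; components-exact  = At.exact
    ; components-unique = At.unique
    }

module _ {c ℓ} (R : CommutativeRing c ℓ) where
  open CommutativeRing R using (Carrier; _≈_; 0#; 1#; -_)
    renaming (_+_ to _+ʳ_; _*_ to _*ʳ_)

  data LinearTerm {a} (X : Set a) : Set (c ⊔ a) where
    gen : X → LinearTerm X
    𝟘   : LinearTerm X
    _⊞_ : LinearTerm X → LinearTerm X → LinearTerm X
    _·_ : Carrier → LinearTerm X → LinearTerm X

  infixl 6 _⊞_
  infixr 7 _·_

  -- The least module congruence containing the relation _~_.

  data Quotient {a r} {X : Set a} (_~_ : Rel (LinearTerm X) r) :
       Rel (LinearTerm X) (c ⊔ ℓ ⊔ a ⊔ r) where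
    rel         : ∀ {x y} → x ~ y → Quotient _~_ x y
    ≋-refl      : ∀ {x} → Quotient _~_ x x
    ≋-sym       : ∀ {x y} → Quotient _~_ x y → Quotient _~_ y x
    ≋-trans     : ∀ {x y z} → Quotient _~_ x y → Quotient _~_ y z → Quotient _~_ x z
    ⊞-cong      : ∀ {x x′ y y′} → Quotient _~_ x x′ → Quotient _~_ y y′ → Quotient _~_ (x ⊞ y) (x′ ⊞ y′)
    ·-cong      : ∀ {s s′ x x′} → s ≈ s′ → Quotient _~_ x x′ → Quotient _~_ (s · x) (s′ · x′)
    ⊞-assoc     : ∀ x y z → Quotient _~_ ((x ⊞ y) ⊞ z) (x ⊞ (y ⊞ z))
    ⊞-comm      : ∀ x y → Quotient _~_ (x ⊞ y) (y ⊞ x)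
    ⊞-identityˡ : ∀ x → Quotient _~_ (𝟘 ⊞ x) x
    ·-zeroˡ     : ∀ x → Quotient _~_ (0# · x) 𝟘
    ·-distribʳ  : ∀ x s t → Quotient _~_ ((s +ʳ t) · x) (s · x ⊞ t · x)
    ·-distribˡ  : ∀ s x y → Quotient _~_ (s · (x ⊞ y)) (s · x ⊞ s · y)
    ·-identityˡ : ∀ x → Quotient _~_ (1# · x) x
    ·-assoc     : ∀ s t x → Quotient _~_ ((s *ʳ t) · x) (s · (t · x))

  private
    module Ring = CommutativeRing R

  presentedModule : ∀ {a r} {X : Set a} → Rel (LinearTerm X) r → Module R (c ⊔ a) (c ⊔ ℓ ⊔ a ⊔ r)
  presentedModule {X = X} _~_ = record
    { Carrierᴹ = LinearTerm X
    ; _≈ᴹ_     = _≋_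
    ; _+ᴹ_     = _⊞_
    ; _*ₗ_     = _·_
    ; 0ᴹ       = 𝟘
    ; -ᴹ_      = - 1# ·_
    ; isModule = IsModuleFromLeft.isModule (record { isLeftModule = isLeftModule })
    }
    where
    _≋_ = Quotient _~_

    ·-zeroʳ : ∀ s → (s · 𝟘) ≋ 𝟘
    ·-zeroʳ s = ≋-trans (·-cong Ring.refl (≋-sym (·-zeroˡ 𝟘)))
      (≋-trans (≋-sym (·-assoc s 0# 𝟘))
      (≋-trans (·-cong (Ring.zeroʳ s) ≋-refl) (·-zeroˡ 𝟘)))

    inverseˡ : ∀ x → ((- 1# · x) ⊞ x) ≋ 𝟘
    inverseˡ x = ≋-trans (⊞-cong ≋-refl (≋-sym (·-identityˡ x)))
      (≋-trans (≋-sym (·-distribʳ x (- 1#) 1#))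
      (≋-trans (·-cong (Ring.-‿inverseˡ 1#) ≋-refl) (·-zeroˡ x)))

    isLeftModule : IsLeftModule Ring.ring _≋_ _⊞_ 𝟘 (- 1# ·_) _·_
    isLeftModule = record
      { isLeftSemimodule = record
        { +ᴹ-isCommutativeMonoid = record
          { isMonoid = record
            { isSemigroup = record
              { isMagma = record
                { isEquivalence = record { refl = ≋-refl ; sym = ≋-sym ; trans = ≋-trans }
                ; ∙-cong        = ⊞-cong
                }
              ; assoc = ⊞-assoc
              }
            ; identity = ⊞-identityˡ , λ x → ≋-trans (⊞-comm x 𝟘) (⊞-identityˡ x)
            }
          ; comm = ⊞-comm
          }
        ; isPreleftSemimodule = record
          { *ₗ-cong      = ·-cong
          ; *ₗ-zeroˡ     = ·-zeroˡ
          ; *ₗ-distribʳ  = ·-distribʳ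
          ; *ₗ-identityˡ = ·-identityˡ
          ; *ₗ-assoc     = ·-assoc
          ; *ₗ-zeroʳ     = ·-zeroʳ
          ; *ₗ-distribˡ  = ·-distribˡ
          }
        }
      ; -ᴹ‿cong    = ·-cong Ring.refl
      ; -ᴹ‿inverse = inverseˡ , λ x → ≋-trans (⊞-comm x (- 1# · x)) (inverseˡ x)
      }

  IsLinear : ∀ {a ℓa b ℓb} (A : Module R a ℓa) (B : Module R b ℓb) →
             (Module.Carrierᴹ A → Module.Carrierᴹ B) → Set (c ⊔ a ⊔ ℓa ⊔ ℓb)
  IsLinear A B = ModuleMorphisms.IsModuleHomomorphism (Module.rawModule A) (Module.rawModule B)

  module Extension {n ℓn} (N : Module R n ℓn) where
    open Module N
    open import Relation.Binary.Reasoning.Setoid ≈ᴹ-setoid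
    open import Algebra.Properties.CommutativeSemigroup
      (CommutativeMonoid.commutativeSemigroup +ᴹ-commutativeMonoid) using (interchange)
    open import Algebra.Module.Properties.LeftModule leftModule using (inverseˡ-uniqueᴹ)

    extend : ∀ {a} {X : Set a} → (X → Carrierᴹ) → LinearTerm X → Carrierᴹ
    extend f (gen x) = f x
    extend f 𝟘       = 0ᴹ
    extend f (x ⊞ y) = extend f x +ᴹ extend f y
    extend f (s · x) = s *ₗ extend f x

    module _ {a} {X : Set a} where

      extend-cong : ∀ {r} {_~_ : Rel (LinearTerm X) r} (f : X → Carrierᴹ) →
        (∀ {x y} → x ~ y → extend f x ≈ᴹ extend f y) →
        ∀ {x y} → Quotient _~_ x y → extend f x ≈ᴹ extend f y
      extend-cong f resp = go
        where
        go : ∀ {x y} → Quotient _ x y → extend f x ≈ᴹ extend f y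
        go (rel r)           = resp r
        go ≋-refl            = ≈ᴹ-refl
        go (≋-sym p)         = ≈ᴹ-sym (go p)
        go (≋-trans p q)     = ≈ᴹ-trans (go p) (go q)
        go (⊞-cong p q)      = +ᴹ-cong (go p) (go q)
        go (·-cong s p)      = *ₗ-cong s (go p)
        go (⊞-assoc _ _ _)   = +ᴹ-assoc _ _ _
        go (⊞-comm _ _)      = +ᴹ-comm _ _
        go (⊞-identityˡ _)   = +ᴹ-identityˡ _
        go (·-zeroˡ _)       = *ₗ-zeroˡ _
        go (·-distribʳ _ _ _) = *ₗ-distribʳ _ _ _
        go (·-distribˡ _ _ _) = *ₗ-distribˡ _ _ _
        go (·-identityˡ _)   = *ₗ-identityˡ _
        go (·-assoc _ _ _)   = *ₗ-assoc _ _ _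

      extend-isLinear : ∀ {r} {_~_ : Rel (LinearTerm X) r} (f : X → Carrierᴹ) →
        (∀ {x y} → x ~ y → extend f x ≈ᴹ extend f y) →
        IsLinear (presentedModule _~_) N (extend f)
      extend-isLinear f resp = record
        { isBimoduleHomomorphism = record
          { +ᴹ-isGroupHomomorphism = record
            { isMonoidHomomorphism = record
              { isMagmaHomomorphism = record
                { isRelHomomorphism = record { cong = extend-cong f resp }
                ; homo = λ _ _ → ≈ᴹ-refl
                }
              ; ε-homo = ≈ᴹ-refl
              }
            ; ⁻¹-homo = λ x → inverseˡ-uniqueᴹ _ _ (begin
                - 1# *ₗ extend f x +ᴹ extend f x         ≈⟨ +ᴹ-congˡ (*ₗ-identityˡ _) ⟨
                - 1# *ₗ extend f x +ᴹ 1# *ₗ extend f x   ≈⟨ *ₗ-distribʳ _ _ _ ⟨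
                (- 1# +ʳ 1#) *ₗ extend f x               ≈⟨ *ₗ-cong (Ring.-‿inverseˡ 1#) ≈ᴹ-refl ⟩
                0# *ₗ extend f x                         ≈⟨ *ₗ-zeroˡ _ ⟩
                0ᴹ                                       ∎)
            }
          ; *ₗ-homo = λ _ _ → ≈ᴹ-refl
          ; *ᵣ-homo = λ s x → *ₗ-*ᵣ-coincident s (extend f x)
          }
        }

      extend-≈ : ∀ {f g : X → Carrierᴹ} → (∀ x → f x ≈ᴹ g x) → ∀ y → extend f y ≈ᴹ extend g y
      extend-≈ f≈g (gen x) = f≈g x
      extend-≈ f≈g 𝟘       = ≈ᴹ-refl
      extend-≈ f≈g (x ⊞ y) = +ᴹ-cong (extend-≈ f≈g x) (extend-≈ f≈g y)
      extend-≈ f≈g (s · x) = *ₗ-cong Ring.refl (extend-≈ f≈g x)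

      extend-+ : ∀ {f g h : X → Carrierᴹ} → (∀ x → f x ≈ᴹ g x +ᴹ h x) →
                 ∀ y → extend f y ≈ᴹ extend g y +ᴹ extend h y
      extend-+ f≈ (gen x) = f≈ x
      extend-+ f≈ 𝟘       = ≈ᴹ-sym (+ᴹ-identityˡ 0ᴹ)
      extend-+ {f} {g} {h} f≈ (x ⊞ y) = begin
        extend f x +ᴹ extend f y                                 ≈⟨ +ᴹ-cong (extend-+ f≈ x) (extend-+ f≈ y) ⟩
        (extend g x +ᴹ extend h x) +ᴹ (extend g y +ᴹ extend h y) ≈⟨ interchange _ _ _ _ ⟩
        (extend g x +ᴹ extend g y) +ᴹ (extend h x +ᴹ extend h y) ∎
      extend-+ {f} {g} {h} f≈ (s · x) = begin
        s *ₗ extend f x                    ≈⟨ *ₗ-cong Ring.refl (extend-+ f≈ x) ⟩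
        s *ₗ (extend g x +ᴹ extend h x)    ≈⟨ *ₗ-distribˡ _ _ _ ⟩
        s *ₗ extend g x +ᴹ s *ₗ extend h x ∎

      extend-· : ∀ {f g : X → Carrierᴹ} s → (∀ x → f x ≈ᴹ s *ₗ g x) →
                 ∀ y → extend f y ≈ᴹ s *ₗ extend g y
      extend-· s f≈ (gen x) = f≈ x
      extend-· s f≈ 𝟘       = ≈ᴹ-sym (*ₗ-zeroʳ s)
      extend-· s f≈ (x ⊞ y) = ≈ᴹ-trans (+ᴹ-cong (extend-· s f≈ x) (extend-· s f≈ y)) (≈ᴹ-sym (*ₗ-distribˡ _ _ _))
      extend-· {f} {g} s f≈ (t · x) = begin
        t *ₗ extend f x         ≈⟨ *ₗ-cong Ring.refl (extend-· s f≈ x) ⟩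
        t *ₗ (s *ₗ extend g x)  ≈⟨ *ₗ-assoc _ _ _ ⟨
        (t *ʳ s) *ₗ extend g x  ≈⟨ *ₗ-cong (Ring.*-comm t s) ≈ᴹ-refl ⟩
        (s *ʳ t) *ₗ extend g x  ≈⟨ *ₗ-assoc _ _ _ ⟩
        s *ₗ (t *ₗ extend g x)  ∎

  record IsBilinear {a ℓa b ℓb n ℓn} (A : Module R a ℓa) (B : Module R b ℓb) (N : Module R n ℓn)
                    (f : Module.Carrierᴹ A → Module.Carrierᴹ B → Module.Carrierᴹ N) :
                    Set (c ⊔ ℓ ⊔ a ⊔ ℓa ⊔ b ⊔ ℓb ⊔ n ⊔ ℓn) where
    private
      module A = Module A
      module B = Module B
      module N = Module N
    field
      bi-cong : ∀ {x x′ y y′} → x A.≈ᴹ x′ → y B.≈ᴹ y′ → f x y N.≈ᴹ f x′ y′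
      bi-+ˡ   : ∀ x x′ y → f (x A.+ᴹ x′) y N.≈ᴹ (f x y N.+ᴹ f x′ y)
      bi-+ʳ   : ∀ x y y′ → f x (y B.+ᴹ y′) N.≈ᴹ (f x y N.+ᴹ f x y′)
      bi-·ˡ   : ∀ s x y → f (s A.*ₗ x) y N.≈ᴹ (s N.*ₗ f x y)
      bi-·ʳ   : ∀ s x y → f x (s B.*ₗ y) N.≈ᴹ (s N.*ₗ f x y)

  Free : ∀ {a} → Set a → Module R (c ⊔ a) (c ⊔ ℓ ⊔ a)
  Free X = presentedModule {r = 0ℓ} {X = X} (λ _ _ → Empty)

  module _ {a ℓa b ℓb} (A : Module R a ℓa) (B : Module R b ℓb) where
    private
      module A = Module A
      module B = Module B

    data TensorRel : Rel (LinearTerm (A.Carrierᴹ × B.Carrierᴹ)) (c ⊔ a ⊔ ℓa ⊔ b ⊔ ℓb) where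
      ⊗-cong : ∀ {x x′ y y′} → x A.≈ᴹ x′ → y B.≈ᴹ y′ → TensorRel (gen (x , y)) (gen (x′ , y′))
      ⊗-+ˡ   : ∀ x x′ y → TensorRel (gen (x A.+ᴹ x′ , y)) (gen (x , y) ⊞ gen (x′ , y))
      ⊗-+ʳ   : ∀ x y y′ → TensorRel (gen (x , y B.+ᴹ y′)) (gen (x , y) ⊞ gen (x , y′))
      ⊗-·ˡ   : ∀ s x y → TensorRel (gen (s A.*ₗ x , y)) (s · gen (x , y))
      ⊗-·ʳ   : ∀ s x y → TensorRel (gen (x , s B.*ₗ y)) (s · gen (x , y))

    Tensor : Module R (c ⊔ a ⊔ b) (c ⊔ ℓ ⊔ a ⊔ ℓa ⊔ b ⊔ ℓb)
    Tensor = presentedModule TensorRel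

    tensor-isBilinear : IsBilinear A B Tensor (λ x y → gen (x , y))
    tensor-isBilinear = record
      { bi-cong = λ p q → rel (⊗-cong p q)
      ; bi-+ˡ   = λ x x′ y → rel (⊗-+ˡ x x′ y)
      ; bi-+ʳ   = λ x y y′ → rel (⊗-+ʳ x y y′)
      ; bi-·ˡ   = λ s x y → rel (⊗-·ˡ s x y)
      ; bi-·ʳ   = λ s x y → rel (⊗-·ʳ s x y)
      }

    bilinear-respects : ∀ {n ℓn} {N : Module R n ℓn} {f} → IsBilinear A B N f →
      ∀ {x y} → TensorRel x y →
      Module._≈ᴹ_ N (Extension.extend N (λ (u , v) → f u v) x) (Extension.extend N (λ (u , v) → f u v) y)
    bilinear-respects bi = λ where
        (⊗-cong p q)     → bi-cong p q
        (⊗-+ˡ x x′ y)    → bi-+ˡ x x′ y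
        (⊗-+ʳ x y y′)    → bi-+ʳ x y y′
        (⊗-·ˡ s x y)     → bi-·ˡ s x y
        (⊗-·ʳ s x y)     → bi-·ʳ s x y
      where open IsBilinear bi

  module BilinearExtension {n ℓn} (N : Module R n ℓn) where
    open Module N
    open Extension N

    extend₂ : ∀ {a b} {X : Set a} {Y : Set b} →
              (X → Y → Carrierᴹ) → LinearTerm X → LinearTerm Y → Carrierᴹ
    extend₂ f x y = extend (λ u → extend (λ v → f u v) y) x

    extend₂-isBilinear : ∀ {a b r s} {X : Set a} {Y : Set b}
      {_~_ : Rel (LinearTerm X) r} {_~′_ : Rel (LinearTerm Y) s} (f : X → Y → Carrierᴹ) →
      (∀ v {x x′} → x ~ x′ → extend (λ u → f u v) x ≈ᴹ extend (λ u → f u v) x′) →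
      (∀ u {y y′} → y ~′ y′ → extend (f u) y ≈ᴹ extend (f u) y′) →
      IsBilinear (presentedModule _~_) (presentedModule _~′_) N (extend₂ f)
    extend₂-isBilinear {_~_ = _~_} f respˡ respʳ = record
      { bi-cong = λ {x} {x′} {y} {y′} p q →
          ≈ᴹ-trans (extend-cong (λ u → extend (f u) y) (λ r → congˡ r y) p)
                   (extend-≈ (λ u → extend-cong (f u) (respʳ u) q) x′)
      ; bi-+ˡ   = λ _ _ _ → ≈ᴹ-refl
      ; bi-+ʳ   = λ x y y′ → extend-+ (λ _ → ≈ᴹ-refl) x
      ; bi-·ˡ   = λ _ _ _ → ≈ᴹ-refl
      ; bi-·ʳ   = λ s x y → extend-· s (λ _ → ≈ᴹ-refl) x
      }
      where
      swap : ∀ x y → extend₂ f x y ≈ᴹ extend (λ v → extend (λ u → f u v) x) y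
      swap (gen u) y = extend-≈ (λ _ → ≈ᴹ-refl) y
      swap 𝟘       y = zero-ext y
        where
        zero-ext : ∀ y → 0ᴹ ≈ᴹ extend (λ _ → 0ᴹ) y
        zero-ext (gen _) = ≈ᴹ-refl
        zero-ext 𝟘       = ≈ᴹ-refl
        zero-ext (x ⊞ y) = ≈ᴹ-trans (≈ᴹ-sym (+ᴹ-identityˡ 0ᴹ)) (+ᴹ-cong (zero-ext x) (zero-ext y))
        zero-ext (s · x) = ≈ᴹ-trans (≈ᴹ-sym (*ₗ-zeroʳ s)) (*ₗ-cong Ring.refl (zero-ext x))
      swap (x ⊞ x′) y = ≈ᴹ-trans (+ᴹ-cong (swap x y) (swap x′ y)) (≈ᴹ-sym (extend-+ (λ _ → ≈ᴹ-refl) y))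
      swap (s · x)  y = ≈ᴹ-trans (*ₗ-cong Ring.refl (swap x y)) (≈ᴹ-sym (extend-· s (λ _ → ≈ᴹ-refl) y))

      congˡ : ∀ {x x′} → x ~ x′ → ∀ y → extend₂ f x y ≈ᴹ extend₂ f x′ y
      congˡ {x} {x′} r y = ≈ᴹ-trans (swap x y)
        (≈ᴹ-trans (extend-≈ (λ v → respˡ v r) y) (≈ᴹ-sym (swap x′ y)))

  -- The product (a ⊗ b)(a′ ⊗ b′) = aa′ ⊗ bb′ on A ⊗ A.

  module TensorProduct {a ℓa} (A : Module R a ℓa)
                       {_∙_ : Module.Carrierᴹ A → Module.Carrierᴹ A → Module.Carrierᴹ A}
                       (∙-isBilinear : IsBilinear A A A _∙_) where
    private
      module A = Module A
      T = Tensor A A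
      module T = Module T
      open IsBilinear ∙-isBilinear

      mul : A.Carrierᴹ × A.Carrierᴹ → A.Carrierᴹ × A.Carrierᴹ → T.Carrierᴹ
      mul (x , y) (x′ , y′) = gen (x ∙ x′ , y ∙ y′)

    infixl 7 _⊛_

    _⊛_ : T.Carrierᴹ → T.Carrierᴹ → T.Carrierᴹ
    _⊛_ = BilinearExtension.extend₂ T mul

    ⊛-isBilinear : IsBilinear T T T _⊛_
    ⊛-isBilinear = BilinearExtension.extend₂-isBilinear T mul
      (λ (x′ , y′) → bilinear-respects A A {N = T} record
        { bi-cong = λ p q → rel (⊗-cong (bi-cong p A.≈ᴹ-refl) (bi-cong q A.≈ᴹ-refl))
        ; bi-+ˡ   = λ x₁ x₂ y → T.≈ᴹ-trans (rel (⊗-cong (bi-+ˡ x₁ x₂ x′) A.≈ᴹ-refl)) (rel (⊗-+ˡ _ _ _))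
        ; bi-+ʳ   = λ x y₁ y₂ → T.≈ᴹ-trans (rel (⊗-cong A.≈ᴹ-refl (bi-+ˡ y₁ y₂ y′))) (rel (⊗-+ʳ _ _ _))
        ; bi-·ˡ   = λ s x y → T.≈ᴹ-trans (rel (⊗-cong (bi-·ˡ s x x′) A.≈ᴹ-refl)) (rel (⊗-·ˡ _ _ _))
        ; bi-·ʳ   = λ s x y → T.≈ᴹ-trans (rel (⊗-cong A.≈ᴹ-refl (bi-·ˡ s y y′))) (rel (⊗-·ʳ _ _ _))
        })
      (λ (x , y) → bilinear-respects A A {N = T} record
        { bi-cong = λ p q → rel (⊗-cong (bi-cong A.≈ᴹ-refl p) (bi-cong A.≈ᴹ-refl q))
        ; bi-+ˡ   = λ x₁ x₂ y′ → T.≈ᴹ-trans (rel (⊗-cong (bi-+ʳ x x₁ x₂) A.≈ᴹ-refl)) (rel (⊗-+ˡ _ _ _))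
        ; bi-+ʳ   = λ x′ y₁ y₂ → T.≈ᴹ-trans (rel (⊗-cong A.≈ᴹ-refl (bi-+ʳ y y₁ y₂))) (rel (⊗-+ʳ _ _ _))
        ; bi-·ˡ   = λ s x′ y′ → T.≈ᴹ-trans (rel (⊗-cong (bi-·ʳ s x x′) A.≈ᴹ-refl)) (rel (⊗-·ˡ _ _ _))
        ; bi-·ʳ   = λ s x′ y′ → T.≈ᴹ-trans (rel (⊗-cong A.≈ᴹ-refl (bi-·ʳ s y y′))) (rel (⊗-·ʳ _ _ _))
        })

module Coproduct {c ℓ} (R : CommutativeRing c ℓ) (G : Graph) (κ : ComponentOrder G) where
  open Graph G using (order)
  open ComponentOrder κ using (components)
  open ConnectedSubgraph using (V; subgraph)

  -- M(𝒢), with unit [] and product _++_.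
  Word : Set
  Word = List (ConnectedSubgraph G)

  H : Module R c (c ⊔ ℓ)
  H = Free R Word

  open Module H public using () renaming (Carrierᴹ to |H|)

  infixl 7 _∙_

  _∙_ : |H| → |H| → |H|
  _∙_ = BilinearExtension.extend₂ R H (λ F F′ → gen (F ++ F′))

  ∙-isBilinear : IsBilinear R H H H _∙_
  ∙-isBilinear = BilinearExtension.extend₂-isBilinear R H _ (λ _ ()) (λ _ ())

  H⊗H : Module R c (c ⊔ ℓ)
  H⊗H = Tensor R H H

  open Module H⊗H public using (_≈ᴹ_; _+ᴹ_; 0ᴹ) renaming (Carrierᴹ to |H⊗H|)
  open TensorProduct R H ∙-isBilinear public using (_⊛_; ⊛-isBilinear)

  infix 8 _⊗_

  _⊗_ : Word → Word → |H⊗H|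
  F ⊗ F′ = gen (gen F , gen F′)

  ∑ : ∀ {a} {A : Set a} → List A → (A → |H⊗H|) → |H⊗H|
  ∑ xs f = List.foldr _+ᴹ_ 0ᴹ (List.map f xs)

  infix 9 _⟦_⟧ _⟦_⟧ᵂ

  -- Γ[U], as an element of M(𝒢).
  _⟦_⟧ : ConnectedSubgraph G → Subset order → Word
  Γ ⟦ U ⟧ = components (induced (subgraph Γ) U)

  Δ-generator : ConnectedSubgraph G → |H⊗H|
  Δ-generator Γ = ∑ (splits (V Γ)) λ (V₁ , V₂) → Γ ⟦ V₁ ⟧ ⊗ Γ ⟦ V₂ ⟧

  -- The product of three or more factors is bracketed to the right.
  Δ-word : Word → |H⊗H|
  Δ-word []           = [] ⊗ []
  Δ-word (Γ ∷ [])     = Δ-generator Γ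
  Δ-word (Γ ∷ Γ′ ∷ F) = List⁺.foldr₁ _⊛_ (List⁺.map Δ-generator (Γ List⁺.∷ Γ′ ∷ F))

  Δ : |H| → |H⊗H|
  Δ = Extension.extend R H⊗H Δ-word

  Δ-linear : IsLinear R H H⊗H Δ
  Δ-linear = Extension.extend-isLinear R H⊗H Δ-word λ ()

  -- The choices (Uᵢ , Vᵢ)ᵢ with Uᵢ ⊔ Vᵢ = V(Γᵢ) for F = Γ₁ ⋯ Γₙ.
  splitFamilies : (F : Word) → List (All (λ _ → Subset order × Subset order) F)
  splitFamilies []      = [] ∷ []
  splitFamilies (Γ ∷ F) = cartesianProductWith _∷_ (splits (V Γ)) (splitFamilies F)

  -- F[U] = Γ₁[U₁] ⋯ Γₙ[Uₙ].
  _⟦_⟧ᵂ : (F : Word) → All (λ _ → Subset order) F → Word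
  []      ⟦ []     ⟧ᵂ = []
  (Γ ∷ F) ⟦ U ∷ Us ⟧ᵂ = Γ ⟦ U ⟧ ++ F ⟦ Us ⟧ᵂ

  Δ-combinatorial-word : Word → |H⊗H|
  Δ-combinatorial-word F =
    ∑ (splitFamilies F) λ S → F ⟦ All.map proj₁ S ⟧ᵂ ⊗ F ⟦ All.map proj₂ S ⟧ᵂ

  Δ-combinatorial : |H| → |H⊗H|
  Δ-combinatorial = Extension.extend R H⊗H Δ-combinatorial-word

  Δ-combinatorial-linear : IsLinear R H H⊗H Δ-combinatorial
  Δ-combinatorial-linear = Extension.extend-isLinear R H⊗H Δ-combinatorial-word λ ()

{-# OPTIONS --safe #-}

-- Both maps are linear, so it suffices to compare them on words.  There the
-- combinatorial formula is multiplicative: a choice for Γ F is a choice for Γ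
-- paired with a choice for F, so by distributivity its sum is the product
-- Δ(Γ) Δ(F).

module Submission where

open import Defs
open import Algebra.Bundles using (CommutativeRing)
open import Algebra.Module.Bundles using (Module)
open import Data.List.Base using (List; []; _∷_; _++_; map; cartesianProductWith)
open import Data.List.Properties using (++-identityʳ)
import Data.List.Relation.Unary.All as All
open import Data.Product.Base using (_,_)
open import Relation.Binary.PropositionalEquality using (cong)
import Relation.Binary.Reasoning.Setoid as SetoidReasoning

module _ {c ℓ} (R : CommutativeRing c ℓ) (G : Graph) (κ : ComponentOrder G) where
  open Coproduct R G κ
  open Module H⊗H using (≈ᴹ-refl; ≈ᴹ-sym; ≈ᴹ-trans; ≈ᴹ-setoid; +ᴹ-cong; +ᴹ-congˡ; +ᴹ-assoc; +ᴹ-identityˡ; +ᴹ-identityʳ; *ₗ-zeroˡ)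
  open IsBilinear ⊛-isBilinear
  open SetoidReasoning ≈ᴹ-setoid
  module H = Module H

  ∑-++ : ∀ {a} {A : Set a} (xs ys : List A) (f : A → |H⊗H|) →
         ∑ (xs ++ ys) f ≈ᴹ (∑ xs f +ᴹ ∑ ys f)
  ∑-++ []       ys f = ≈ᴹ-sym (+ᴹ-identityˡ _)
  ∑-++ (x ∷ xs) ys f = ≈ᴹ-trans (+ᴹ-congˡ (∑-++ xs ys f)) (≈ᴹ-sym (+ᴹ-assoc _ _ _))

  ⊛-congˡ : ∀ x {y z} → y ≈ᴹ z → (x ⊛ y) ≈ᴹ (x ⊛ z)
  ⊛-congˡ x = bi-cong (≈ᴹ-refl {x})

  -- Homogeneity in the right factor suffices: `0ᴹ` is `0# · 0ᴹ`, and the scalar comes out.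
  ⊛-zeroʳ : ∀ x → (x ⊛ 0ᴹ) ≈ᴹ 0ᴹ
  ⊛-zeroʳ x = begin
    x ⊛ 0ᴹ          ≈⟨ ⊛-congˡ x (*ₗ-zeroˡ 0ᴹ) ⟨
    x ⊛ (0# · 0ᴹ)   ≈⟨ bi-·ʳ 0# x 0ᴹ ⟩
    0# · (x ⊛ 0ᴹ)   ≈⟨ *ₗ-zeroˡ _ ⟩
    0ᴹ              ∎
    where open CommutativeRing R using (0#)

  ∑-map-⊛ : ∀ {a b} {A : Set a} {B : Set b} x (g : A → B) (h : B → |H⊗H|) (k : A → |H⊗H|) →
            (∀ y → h (g y) ≈ᴹ (x ⊛ k y)) → ∀ ys → ∑ (map g ys) h ≈ᴹ (x ⊛ ∑ ys k)
  ∑-map-⊛ x g h k h≈ []       = ≈ᴹ-sym (⊛-zeroʳ x)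
  ∑-map-⊛ x g h k h≈ (y ∷ ys) =
    ≈ᴹ-trans (+ᴹ-cong (h≈ y) (∑-map-⊛ x g h k h≈ ys)) (≈ᴹ-sym (bi-+ʳ x (k y) (∑ ys k)))

  -- Distributivity of `_⊛_` over finite sums. As `_⊛_` recurses on its left argument, left
  -- distributivity holds by computation; only the right one, in `∑-map-⊛`, uses bilinearity.
  ∑-cartesianProductWith : ∀ {a b d} {A : Set a} {B : Set b} {D : Set d}
    (f : A → B → D) (g : A → |H⊗H|) (h : D → |H⊗H|) (k : B → |H⊗H|) →
    (∀ x y → h (f x y) ≈ᴹ (g x ⊛ k y)) →
    ∀ xs ys → ∑ (cartesianProductWith f xs ys) h ≈ᴹ (∑ xs g ⊛ ∑ ys k)
  ∑-cartesianProductWith f g h k h≈ []       ys = ≈ᴹ-refl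
  ∑-cartesianProductWith f g h k h≈ (x ∷ xs) ys = ≈ᴹ-trans (∑-++ (map (f x) ys) _ h)
    (+ᴹ-cong (∑-map-⊛ (g x) (f x) h k (h≈ x) ys) (∑-cartesianProductWith f g h k h≈ xs ys))

  -- Induction on the term, because `_∙_` computes on its left argument.
  ∙-identityʳ : ∀ x → (x ∙ gen []) H.≈ᴹ x
  ∙-identityʳ (gen F) = H.≈ᴹ-reflexive (cong gen (++-identityʳ F))
  ∙-identityʳ 𝟘       = H.≈ᴹ-refl
  ∙-identityʳ (x ⊞ y) = ⊞-cong (∙-identityʳ x) (∙-identityʳ y)
  ∙-identityʳ (s · x) = ·-cong (CommutativeRing.refl R) (∙-identityʳ x)

  ⊛-identityʳ : ∀ x → (x ⊛ ([] ⊗ [])) ≈ᴹ x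
  ⊛-identityʳ (gen (x , y)) = rel (⊗-cong (∙-identityʳ x) (∙-identityʳ y))
  ⊛-identityʳ 𝟘             = ≈ᴹ-refl
  ⊛-identityʳ (x ⊞ y)       = ⊞-cong (⊛-identityʳ x) (⊛-identityʳ y)
  ⊛-identityʳ (s · x)       = ·-cong (CommutativeRing.refl R) (⊛-identityʳ x)

  Δ-word-∷ : ∀ Γ F → Δ-word (Γ ∷ F) ≈ᴹ (Δ-generator Γ ⊛ Δ-word F)
  -- A one-letter word has its own clause in `Δ-word`, so the factor `[] ⊗ []` has to be absorbed.
  -- Longer words unfold to the product.
  Δ-word-∷ Γ []           = ≈ᴹ-sym (⊛-identityʳ (Δ-generator Γ))
  Δ-word-∷ Γ (Γ′ ∷ [])    = ≈ᴹ-refl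
  Δ-word-∷ Γ (Γ′ ∷ _ ∷ F) = ≈ᴹ-refl

  -- For each pair of choices the summand is, by computation, the product of the two tensors, since
  -- `_⟦_⟧ᵂ` concatenates. The order of components never enters.
  Δ-combinatorial-word-∷ : ∀ Γ F →
    Δ-combinatorial-word (Γ ∷ F) ≈ᴹ (Δ-generator Γ ⊛ Δ-combinatorial-word F)
  Δ-combinatorial-word-∷ Γ F =
    ∑-cartesianProductWith All._∷_ _ _ _ (λ _ _ → ≈ᴹ-refl) (splits (ConnectedSubgraph.V Γ)) (splitFamilies F)

  Δ-combinatorial-word≈Δ-word : ∀ F → Δ-combinatorial-word F ≈ᴹ Δ-word F
  -- The empty word has exactly one family of choices, so the sum is `[] ⊗ []` plus the final `0ᴹ`.
  Δ-combinatorial-word≈Δ-word []      = +ᴹ-identityʳ _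
  Δ-combinatorial-word≈Δ-word (Γ ∷ F) = begin
    Δ-combinatorial-word (Γ ∷ F)             ≈⟨ Δ-combinatorial-word-∷ Γ F ⟩
    Δ-generator Γ ⊛ Δ-combinatorial-word F   ≈⟨ ⊛-congˡ (Δ-generator Γ) (Δ-combinatorial-word≈Δ-word F) ⟩
    Δ-generator Γ ⊛ Δ-word F                 ≈⟨ Δ-word-∷ Γ F ⟨
    Δ-word (Γ ∷ F)                           ∎

proposition2p11 : ∀ {c ℓ} (R : CommutativeRing c ℓ) (G : Graph) (κ : ComponentOrder G) →
    let open Coproduct R G κ in
    ∀ (x : |H|) → Δ-combinatorial x ≈ᴹ Δ x
proposition2p11 R G κ =
  Extension.extend-≈ R (Coproduct.H⊗H R G κ) (Δ-combinatorial-word≈Δ-word R G κ)
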